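{- Let $A$ be a finite alphabet with at least two letters and let $r\ge 1$. Then for every sufficiently large dimension $n$ there is a collection $\mathscr{L}\subseteq \mathscr{L}(A^n)$ of combinatorial lines containing neither tripods nor triangles such that $\chi(\mathscr{L})>r$, i.e., for every colouring of $A^n$ with $r$ colours some line in $\mathscr{L}$ is monochromatic.
   Context: For a finite set $A$, a combinatorial line in $A^n$ is the image of a map $\eta\colon A\to A^n$ for which there is a partition $[n]=C\cup M_L$ with $M_L\ne\emptyset$ (the moving coordinates) such that, writing $\eta(a)=(u_{a1},\dots,u_{an})$, the entries $u_{ac}$ for $c\in C$ do not depend on $a$, and $u_{am}=a$ for all $a\in A$, $m\in M_L$. $\mathscr{L}(A^n)$ denotes the set of all combinatorial lines in $A^n$, and a set $\mathscr{L}\subseteq\mathscr{L}(A^n)$ is regarded as the $|A|$-uniform hypergraph on $A^n$ with edge set $\mathscr{L}$; $\chi(\mathscr{L})$ is its chromatic number. Three distinct lines form a triangle if any two of them intersect but they do not pass through a common point. Three distinct lines $L,L',L''$ passing through a common point form a tripod if the moving coordinate set $M_L$ is the disjoint union of $M_{L'}$ and $M_{L''}$. -}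

module Defs where

open import Data.Nat using (ℕ)
open import Data.Fin using (Fin)
open import Data.Vec using (Vec; lookup; map)
open import Data.Maybe using (Maybe; just; nothing; fromMaybe)
open import Data.Product using (Σ; ∃; ∃-syntax; _×_)
open import Data.Sum using (_⊎_)
open import Data.List using (List)
open import Data.List.Membership.Propositional using (_∈_)
open import Relation.Binary.PropositionalEquality using (_≡_; _≢_)
open import Relation.Nullary using (¬_)

Point : ℕ → ℕ → Set
Point k n = Vec (Fin k) n

-- A template w : Vec (Maybe (Fin k)) n: coordinate i is constant (just x) or moving (nothing).
Template : ℕ → ℕ → Set
Template k n = Vec (Maybe (Fin k)) n

η : ∀ {k n} → Template k n → Fin k → Point k n
η w a = map (fromMaybe a) w

IsLine : ∀ {k n} → Template k n → Set
IsLine {n = n} w = ∃[ i ] lookup w i ≡ nothing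

Moving : ∀ {k n} → Template k n → Fin n → Set
Moving w i = lookup w i ≡ nothing

-- distinct lines (for k ≥ 2, a line determines its template)
Distinct : ∀ {k n} → Template k n → Template k n → Set
Distinct w w' = w ≢ w'

OnLine : ∀ {k n} → Point k n → Template k n → Set
OnLine p w = ∃[ a ] η w a ≡ p

Intersect : ∀ {k n} → Template k n → Template k n → Set
Intersect {k} {n} w w' = Σ (Point k n) λ p → OnLine p w × OnLine p w'

CommonPoint : ∀ {k n} → Template k n → Template k n → Template k n → Set
CommonPoint {k} {n} w w' w'' = Σ (Point k n) λ p → OnLine p w × OnLine p w' × OnLine p w''

PairwiseDistinct : ∀ {k n} → Template k n → Template k n → Template k n → Set
PairwiseDistinct w w' w'' = Distinct w w' × Distinct w w'' × Distinct w' w''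

Triangle : ∀ {k n} → Template k n → Template k n → Template k n → Set
Triangle w w' w'' =
  PairwiseDistinct w w' w'' ×
  Intersect w w' × Intersect w w'' × Intersect w' w'' ×
  ¬ CommonPoint w w' w''

DisjointUnionMoving : ∀ {k n} → Template k n → Template k n → Template k n → Set
DisjointUnionMoving {n = n} w w' w'' =
  (∀ (i : Fin n) → Moving w i → Moving w' i ⊎ Moving w'' i) ×
  (∀ (i : Fin n) → Moving w' i → Moving w i) ×
  (∀ (i : Fin n) → Moving w'' i → Moving w i) ×
  (∀ (i : Fin n) → ¬ (Moving w' i × Moving w'' i))

Tripod : ∀ {k n} → Template k n → Template k n → Template k n → Set
Tripod w w' w'' =
  PairwiseDistinct w w' w'' × CommonPoint w w' w'' × DisjointUnionMoving w w' w''

NoTriangles : ∀ {k n} → List (Template k n) → Set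
NoTriangles 𝓛 = ∀ {w w' w''} → w ∈ 𝓛 → w' ∈ 𝓛 → w'' ∈ 𝓛 → ¬ Triangle w w' w''

NoTripods : ∀ {k n} → List (Template k n) → Set
NoTripods 𝓛 = ∀ {w w' w''} → w ∈ 𝓛 → w' ∈ 𝓛 → w'' ∈ 𝓛 → ¬ Tripod w w' w''

Monochromatic : ∀ {k n r} → (Point k n → Fin r) → Template k n → Set
Monochromatic {k} c w = ∀ (a b : Fin k) → c (η w a) ≡ c (η w b)

ChromaticGt : ∀ {k n} → List (Template k n) → ℕ → Set
ChromaticGt {k} {n} 𝓛 r = ∀ (c : Point k n → Fin r) → ∃[ w ] (w ∈ 𝓛 × Monochromatic c w)

{-# OPTIONS --safe #-}
-- First, Shelah's proof of the Hales–Jewett theorem by induction on the alphabet yields a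
-- tripod-free system: two lines through a point that share a moving block have intersecting
-- moving intervals there, so a tripod would already be one on the level of blocks, over the
-- smaller alphabet.  Second, a partite construction removes the triangles.  Begin with pairwise
-- disjoint copies of the lines of a Hales–Jewett system in A^m and treat the points x of A^m one
-- by one: if B is the fibre over x of the current system in A^n, glue one copy of that system
-- along every line of a tripod-free system in B^N ⊆ A^(nN).  Different copies meet only over x,
-- and every line has at most one point over x, so no triangle or tripod arises; and in some copy
-- the fibre over x is monochromatic.
module Submission where

open import Defs
open import Data.Nat using (ℕ; zero; suc; _+_; _*_; _^_; _≤_; _<_; _⊔_; z≤n; s≤s)
open import Data.Nat.Properties using (≤-refl; <-≤-trans; <-trans; <⇒≤; ≮⇒≥; <⇒≱; _<?_; _≟_; n<1+n; m≤m⊔n; m≤n⊔m; ⊔-lub; ≤-pred; m<1+n⇒m<n∨m≡n; ≤⇒≤′)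
open import Data.Nat.Base using (_≤′_; ≤′-refl; ≤′-step)
open import Data.Fin as Fin using (Fin; zero; suc; toℕ; fromℕ<; combine; funToFin; finToFun; _↑ˡ_; _↑ʳ_)
open import Data.Fin.Properties using (toℕ<n; toℕ-fromℕ<; toℕ-injective; suc-injective; finToFun-funToFin; funToFin-finToFin; pigeonhole; any?)
open import Data.Vec using (Vec; []; _∷_; lookup; map; tabulate; concat; _++_; take; group)
open import Data.Vec.Properties using (lookup-map; lookup∘tabulate; tabulate∘lookup; tabulate-cong; tabulate-∘; map-++; map-∘; map-cong; map-id; map-concat; ++-injective; take++drop≡id; ++-injectiveˡ; ++-injectiveʳ; lookup-++ˡ; lookup-++ʳ; lookup-concat; ∷-injectiveˡ; ∷-injectiveʳ)
open import Data.Maybe as Maybe using (Maybe; just; nothing; fromMaybe; maybe)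
open import Data.Maybe.Properties using (≡-dec)
open import Data.Product using (Σ; ∃; ∃-syntax; ∃₂; _×_; _,_; proj₁; proj₂)
open import Data.Sum using (_⊎_; inj₁; inj₂) renaming (map to map-⊎)
open import Data.Empty using (⊥)
open import Data.List as List using (List; []; _∷_; allFin; cartesianProduct; cartesianProductWith; filter)
open import Data.List.Membership.Propositional using (_∈_)
open import Data.List.Membership.Propositional.Properties using (∈-map⁺; ∈-map⁻; ∈-filter⁺; ∈-filter⁻; ∈-allFin; ∈-cartesianProduct⁺; ∈-cartesianProductWith⁺; ∈-cartesianProductWith⁻)
open import Data.List.Relation.Unary.Any using (here)
open import Data.List.Relation.Unary.All as All using (All)
open import Function using (_∘_)
open import Relation.Binary.PropositionalEquality using (_≡_; _≢_; _≗_; refl; sym; trans; cong; cong₂; subst; subst₂; module ≡-Reasoning)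
open import Relation.Nullary using (¬_; Dec; yes; no; contradiction)
open import Relation.Nullary.Decidable using (_×-dec_)
open import Relation.Unary using (Decidable)

-- Vectors: extensionality and injectivity.

lookup-ext : ∀ {A : Set} {n} {xs ys : Vec A n} → lookup xs ≗ lookup ys → xs ≡ ys
lookup-ext {xs = xs} {ys} eq =
  trans (sym (tabulate∘lookup xs)) (trans (tabulate-cong eq) (tabulate∘lookup ys))

concat-injective : ∀ {A : Set} {m n} (xss yss : Vec (Vec A m) n) → concat xss ≡ concat yss → xss ≡ yss
concat-injective []         []         _  = refl
concat-injective (xs ∷ xss) (ys ∷ yss) eq =
  cong₂ _∷_ (++-injectiveˡ xs ys eq) (concat-injective xss yss (++-injectiveʳ xs ys eq))

take-++ : ∀ {A : Set} {m n} (xs : Vec A m) (ys : Vec A n) → take m (xs ++ ys) ≡ xs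
take-++ {m = m} xs ys = ++-injectiveˡ (take m (xs ++ ys)) xs (take++drop≡id m (xs ++ ys))

map-injective : ∀ {A B : Set} {n} {f : A → B} → (∀ {x y} → f x ≡ f y → x ≡ y) →
  {xs ys : Vec A n} → map f xs ≡ map f ys → xs ≡ ys
map-injective f-inj {[]}     {[]}     _  = refl
map-injective f-inj {x ∷ xs} {y ∷ ys} eq =
  cong₂ _∷_ (f-inj (∷-injectiveˡ eq)) (map-injective f-inj (∷-injectiveʳ eq))

-- Numbering of points and finite subsets.

encode : ∀ {k n} → Point k n → Fin (k ^ n)
encode p = funToFin (lookup p)

decode : ∀ {k n} → Fin (k ^ n) → Point k n
decode {k} {n} x = tabulate (finToFun {k} {n} x)

decode-encode : ∀ {k n} (p : Point k n) → decode (encode p) ≡ p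
decode-encode p = trans (tabulate-cong (finToFun-funToFin (lookup p))) (tabulate∘lookup p)

encode-injective : ∀ {k n} {p q : Point k n} → encode p ≡ encode q → p ≡ q
encode-injective {k} {n} {p} {q} eq =
  trans (sym (decode-encode p)) (trans (cong (decode {k} {n}) eq) (decode-encode q))

funToFin-cong : ∀ {m n} {f g : Fin m → Fin n} → f ≗ g → funToFin f ≡ funToFin g
funToFin-cong {zero}  _ = refl
funToFin-cong {suc m} h = cong₂ combine (h zero) (funToFin-cong (h ∘ suc))

encode-decode : ∀ {k n} (x : Fin (k ^ n)) → encode (decode {k} {n} x) ≡ x
encode-decode {k} {n} x = trans (funToFin-cong (lookup∘tabulate (finToFun {k} {n} x)))
  (funToFin-finToFin {n} {k} x)

decode-injective : ∀ {k n} {x y : Fin (k ^ n)} → decode {k} {n} x ≡ decode y → x ≡ y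
decode-injective {k} {n} {x} {y} eq =
  trans (sym (encode-decode {k} {n} x)) (trans (cong encode eq) (encode-decode {k} {n} y))

-- Presents a decidable subset as `Fin size`, so that a fibre can serve as an alphabet.
record Enumeration {n : ℕ} (P : Fin n → Set) : Set where
  field
    size      : ℕ
    elem      : Fin size → Fin n
    injective : ∀ {i j} → elem i ≡ elem j → i ≡ j
    sound     : ∀ i → P (elem i)
    complete  : ∀ x → P x → ∃[ i ] elem i ≡ x

enumerate : ∀ {n} {P : Fin n → Set} → Decidable P → Enumeration P
enumerate {zero} P? = record
  { size = 0 ; elem = λ () ; injective = λ { {()} } ; sound = λ () ; complete = λ () }
enumerate {suc n} {P} P? with P? zero | enumerate (P? ∘ suc)
... | no ¬p | E = record
  { size      = size
  ; elem      = suc ∘ elem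
  ; injective = injective ∘ suc-injective
  ; sound     = sound
  ; complete  = λ { zero p → contradiction p ¬p
                  ; (suc x) p → let i , eq = complete x p in i , cong suc eq }
  }
  where
  open Enumeration E
... | yes p | E = record
  { size      = suc size
  ; elem      = elem′
  ; injective = λ {i} {j} → inj {i} {j}
  ; sound     = λ { zero → p ; (suc i) → sound i }
  ; complete  = λ { zero _ → zero , refl
                  ; (suc x) q → let i , eq = complete x q in suc i , cong suc eq }
  }
  where
  open Enumeration E
  elem′ : Fin (suc size) → Fin (suc n)
  elem′ zero    = zero
  elem′ (suc i) = suc (elem i)
  inj : ∀ {i j} → elem′ i ≡ elem′ j → i ≡ j
  inj {zero}  {zero}  _  = refl
  inj {suc i} {suc j} eq = cong suc (injective (suc-injective eq))

-- Tripods, coordinate by coordinate.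

-- The tripod condition at a single coordinate. In this form it restricts to any set of coordinates,
-- in particular to one block.
record Joint {A : Set} (a : A) (x x′ x″ : Maybe A) : Set where
  field
    agree′   : fromMaybe a x ≡ fromMaybe a x′
    agree″   : fromMaybe a x ≡ fromMaybe a x″
    cover    : x ≡ nothing → x′ ≡ nothing ⊎ x″ ≡ nothing
    sub′     : x′ ≡ nothing → x ≡ nothing
    sub″     : x″ ≡ nothing → x ≡ nothing
    disjoint : x′ ≡ nothing → x″ ≡ nothing → ⊥

open Joint

-- A tripod whose common point carries the same letter a on all three lines; distinctness is
-- automatic once the moving sets are nonempty.
Tripodal : ∀ {k n} → Fin k → (w w′ w″ : Template k n) → Set
Tripodal a w w′ w″ = ∀ i → Joint a (lookup w i) (lookup w′ i) (lookup w″ i)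

TripodFree : ∀ {k n} → List (Template k n) → Set
TripodFree 𝓛 = ∀ {w w′ w″} → w ∈ 𝓛 → w′ ∈ 𝓛 → w″ ∈ 𝓛 → ∀ a → ¬ Tripodal a w w′ w″

lookup-η : ∀ {k n} (w : Template k n) a i → lookup (η w a) i ≡ fromMaybe a (lookup w i)
lookup-η w a i = lookup-map i (fromMaybe a) w

η-moving : ∀ {k n} (w : Template k n) a {i} → Moving w i → lookup (η w a) i ≡ a
η-moving w a {i} m = trans (lookup-η w a i) (cong (fromMaybe a) m)

η-injective : ∀ {k n} {w : Template k n} → IsLine w → ∀ {a b} → η w a ≡ η w b → a ≡ b
η-injective {w = w} (i , m) {a} {b} eq =
  trans (sym (η-moving w a m)) (trans (cong (λ p → lookup p i) eq) (η-moving w b m))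

agree : ∀ {k n} (w w′ : Template k n) {a b} → η w a ≡ η w′ b →
  ∀ i → fromMaybe a (lookup w i) ≡ fromMaybe b (lookup w′ i)
agree w w′ {a} {b} eq i =
  trans (sym (lookup-η w a i)) (trans (cong (λ p → lookup p i) eq) (lookup-η w′ b i))

tripodal : ∀ {k n} {w w′ w″ : Template k n} {a} → η w a ≡ η w′ a → η w a ≡ η w″ a →
  DisjointUnionMoving w w′ w″ → Tripodal a w w′ w″
tripodal {w = w} {w′} {w″} e′ e″ (c , s′ , s″ , d) i = record
  { agree′ = agree w w′ e′ i ; agree″ = agree w w″ e″ i
  ; cover = c i ; sub′ = s′ i ; sub″ = s″ i ; disjoint = λ m′ m″ → d i (m′ , m″) }

tripodal⇒η′ : ∀ {k n} {w w′ w″ : Template k n} {a} → Tripodal a w w′ w″ → η w a ≡ η w′ a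
tripodal⇒η′ {w = w} {w′} {a = a} T = lookup-ext λ i →
  trans (lookup-η w a i) (trans (agree′ (T i)) (sym (lookup-η w′ a i)))

tripodal⇒η″ : ∀ {k n} {w w′ w″ : Template k n} {a} → Tripodal a w w′ w″ → η w a ≡ η w″ a
tripodal⇒η″ {w = w} {w″ = w″} {a} T = lookup-ext λ i →
  trans (lookup-η w a i) (trans (agree″ (T i)) (sym (lookup-η w″ a i)))

¬tripodal-same : ∀ {k n} {w : Template k n} → IsLine w → ∀ a → ¬ Tripodal a w w w
¬tripodal-same (i , m) a T = disjoint (T i) m m

moving-letter : ∀ {k n} {w w′ : Template k n} {a b i} → η w a ≡ η w′ b →
  Moving w i → Moving w′ i → a ≡ b
moving-letter {w = w} {w′} {a} {b} {i} eq m m′ =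
  trans (cong (fromMaybe a) (sym m)) (trans (agree w w′ eq i) (cong (fromMaybe b) m′))

-- The moving sets of `w′` and `w″` are nonempty and contained in that of `w`. At a shared moving
-- coordinate two lines show their parameters, so the common point has the same parameter on all
-- three lines.
tripodFree⇒noTripods : ∀ {k n} {𝓛 : List (Template k n)} →
  (∀ {w} → w ∈ 𝓛 → IsLine w) → TripodFree 𝓛 → NoTripods 𝓛
tripodFree⇒noTripods isLine free {w} {w′} {w″} w∈ w′∈ w″∈
  (_ , (p , (a , e) , (a′ , e′) , (a″ , e″)) , D@(_ , s′ , s″ , _))
  with isLine w′∈ | isLine w″∈
... | i′ , m′ | i″ , m″
  with refl ← moving-letter {w = w} {w′} (trans e (sym e′)) (s′ i′ m′) m′
     | refl ← moving-letter {w = w} {w″} (trans e (sym e″)) (s″ i″ m″) m″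
  = free w∈ w′∈ w″∈ a (tripodal {w = w} {w′} {w″} (trans e (sym e′)) (trans e (sym e″)) D)

-- Tripod-free Hales-Jewett systems and partially opened cubes.

record HalesJewett (k r n : ℕ) : Set where
  field
    𝓛          : List (Template k n)
    isLine     : ∀ {w} → w ∈ 𝓛 → IsLine w
    tripodFree : TripodFree 𝓛
    ramsey     : ChromaticGt 𝓛 r

merge : ∀ {k} → Fin (suc (suc k)) → Fin (suc k)
merge zero    = zero
merge (suc a) = a

-- Shelah's argument with the blocks opened one at a time: the first component lives in the
-- coordinates not yet opened, where the letters 0 and 1 are still identified by `merge`.
record Mixed (k r u s : ℕ) : Set where
  field
    items      : List (Template (suc k) u × Template (suc (suc k)) s)
    isLine     : ∀ {w v} → (w , v) ∈ items → IsLine w ⊎ IsLine v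
    tripodFree : ∀ {w w′ w″ v v′ v″} → (w , v) ∈ items → (w′ , v′) ∈ items → (w″ , v″) ∈ items →
                 ∀ a → Tripodal (merge a) w w′ w″ → Tripodal a v v′ v″ → ⊥
    ramsey     : (c : Point (suc k) u → Point (suc (suc k)) s → Fin r) →
                 ∃₂ λ w v → (w , v) ∈ items ×
                   (∀ a b → c (η w (merge a)) (η v a) ≡ c (η w (merge b)) (η v b))

-- Shelah's blocks with one interval.

module _ {k : ℕ} where

  K : ℕ
  K = suc (suc k)

  one : Fin K
  one = suc zero

  -- Coordinate t of the block 1^i x^(j-i) 0^(N-j), where x is a letter or moving.
  piece : ℕ → ℕ → Maybe (Fin (suc k)) → ℕ → Maybe (Fin K)
  piece i j x t with t <? i | t <? j
  ... | yes _ | _     = just one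
  ... | no _  | yes _ = Maybe.map suc x
  ... | no _  | no _  = just zero

  data Region (i j t : ℕ) (x : Maybe (Fin (suc k))) : Maybe (Fin K) → Set where
    left  : t < i → Region i j t x (just one)
    mid   : i ≤ t → t < j → Region i j t x (Maybe.map suc x)
    right : i ≤ t → j ≤ t → Region i j t x (just zero)

  region : ∀ i j t x → Region i j t x (piece i j x t)
  region i j t x with t <? i | t <? j
  ... | yes p | _     = left p
  ... | no p  | yes q = mid (≮⇒≥ p) q
  ... | no p  | no q  = right (≮⇒≥ p) (≮⇒≥ q)

  piece-left : ∀ {i} j x {t} → t < i → piece i j x t ≡ just one
  piece-left {i} j x {t} p with piece i j x t | region i j t x
  ... | _ | left _    = refl
  ... | _ | mid q _   = contradiction q (<⇒≱ p)
  ... | _ | right q _ = contradiction q (<⇒≱ p)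

  piece-mid : ∀ {i j} x {t} → i ≤ t → t < j → piece i j x t ≡ Maybe.map suc x
  piece-mid {i} {j} x {t} p q with piece i j x t | region i j t x
  ... | _ | left p′    = contradiction p (<⇒≱ p′)
  ... | _ | mid _ _    = refl
  ... | _ | right _ q′ = contradiction q′ (<⇒≱ q)

  piece-right : ∀ {i j} x {t} → i ≤ t → j ≤ t → piece i j x t ≡ just zero
  piece-right {i} {j} x {t} p q with piece i j x t | region i j t x
  ... | _ | left p′   = contradiction p (<⇒≱ p′)
  ... | _ | mid _ q′  = contradiction q (<⇒≱ q′)
  ... | _ | right _ _ = refl

  piece-nothing : ∀ i j x t → piece i j x t ≡ nothing → x ≡ nothing
  piece-nothing i j x t eq with piece i j x t | region i j t x
  piece-nothing i j nothing t _ | _ | mid _ _ = refl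

  merge-lift : ∀ a x → merge (fromMaybe a (Maybe.map suc x)) ≡ fromMaybe (merge {k} a) x
  merge-lift a nothing  = refl
  merge-lift a (just _) = refl

  -- Look at coordinate `i`, where the first block shows its letter. The second block shows there 1
  -- or 0, both merged to `zero`, or its own letter.
  letter-half : ∀ {N i j i′ j′} a x x′ → i < j → j ≤ N →
    (∀ t → t < N → fromMaybe a (piece i j x t) ≡ fromMaybe a (piece i′ j′ x′ t)) →
    fromMaybe (merge a) x ≡ zero ⊎ fromMaybe (merge a) x ≡ fromMaybe (merge a) x′
  letter-half {N} {i} {j} {i′} {j′} a x x′ i<j j≤N h =
    map-⊎ (trans here-x) (trans here-x) (there-x′ (piece i′ j′ x′ i) (region i′ j′ i x′))
    where
    here-x : fromMaybe (merge a) x ≡ merge (fromMaybe a (piece i′ j′ x′ i))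
    here-x = trans (sym (merge-lift a x)) (cong merge
      (trans (cong (fromMaybe a) (sym (piece-mid x ≤-refl i<j))) (h i (<-≤-trans i<j j≤N))))
    there-x′ : ∀ y → Region i′ j′ i x′ y →
      merge (fromMaybe a y) ≡ zero ⊎ merge (fromMaybe a y) ≡ fromMaybe (merge a) x′
    there-x′ _ (left _)    = inj₁ refl
    there-x′ _ (mid _ _)   = inj₂ (merge-lift a x′)
    there-x′ _ (right _ _) = inj₁ refl

  -- Apply `letter-half` both ways: either one application gives the equality, or both letters are
  -- `zero`.
  letter : ∀ {N i j i′ j′} a x x′ → i < j → j ≤ N → i′ < j′ → j′ ≤ N →
    (∀ t → t < N → fromMaybe a (piece i j x t) ≡ fromMaybe a (piece i′ j′ x′ t)) →
    fromMaybe (merge a) x ≡ fromMaybe (merge a) x′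
  letter {N} {i} {j} {i′} {j′} a x x′ p q p′ q′ h
    with letter-half {N} {i} {j} {i′} {j′} a x x′ p q h
       | letter-half {N} {i′} {j′} {i} {j} a x′ x p′ q′ (λ t l → sym (h t l))
  ... | inj₂ eq | _        = eq
  ... | inj₁ _  | inj₂ eq  = sym eq
  ... | inj₁ z  | inj₁ z′  = trans z (sym z′)

  -- If [i,j) lies left of [i′,j′), then at i the second line shows 1 and at i′ the first one
  -- shows 0, so the common letter a would be both.
  ¬apart : ∀ {N i j i′ j′} a → i < j → i′ < j′ → j′ ≤ N →
    (∀ t → t < N → fromMaybe a (piece i j nothing t) ≡ fromMaybe a (piece i′ j′ nothing t)) →
    ¬ (j ≤ i′)
  ¬apart {N} {i} {j} {i′} {j′} a i<j i′<j′ j′≤N h j≤i′ = one≢zero (trans (sym a≡one) a≡zero)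
    where
    i<i′ = <-≤-trans i<j j≤i′
    i′<N = <-≤-trans i′<j′ j′≤N
    a≡one : a ≡ one
    a≡one = trans (cong (fromMaybe a) (sym (piece-mid nothing ≤-refl i<j)))
      (trans (h i (<-trans i<i′ i′<N)) (cong (fromMaybe a) (piece-left j′ nothing i<i′)))
    a≡zero : a ≡ zero
    a≡zero = trans (cong (fromMaybe a) (sym (piece-mid nothing ≤-refl i′<j′)))
      (trans (sym (h i′ i′<N)) (cong (fromMaybe a) (piece-right nothing (<⇒≤ i<i′) j≤i′)))
    one≢zero : one ≢ zero
    one≢zero ()

  -- By `¬apart` neither interval lies left of the other, so the larger of the two left ends belongs
  -- to both.
  overlapping : ∀ {N i j i′ j′} a → i < j → j ≤ N → i′ < j′ → j′ ≤ N →
    (∀ t → t < N → fromMaybe a (piece i j nothing t) ≡ fromMaybe a (piece i′ j′ nothing t)) →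
    ∃[ t ] (t < N × piece i j nothing t ≡ nothing × piece i′ j′ nothing t ≡ nothing)
  overlapping {N} {i} {j} {i′} {j′} a i<j j≤N i′<j′ j′≤N h with i′ <? j | i <? j′
  ... | no p  | _     = contradiction (≮⇒≥ p) (¬apart a i<j i′<j′ j′≤N h)
  ... | _     | no p  = contradiction (≮⇒≥ p) (¬apart a i′<j′ i<j j≤N (λ t l → sym (h t l)))
  ... | yes p | yes q = i ⊔ i′ , <-≤-trans below j≤N
    , piece-mid nothing (m≤m⊔n i i′) below
    , piece-mid nothing (m≤n⊔m i i′) (⊔-lub q i′<j′)
    where
    below : i ⊔ i′ < j
    below = ⊔-lub i<j p

  -- Whether a block's symbol moves can be read off at the left end of its interval. If `x′` and
  -- `x″` both moved, their intervals would overlap and the blocks would share a moving coordinate.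
  joint-head : ∀ {N i j i′ j′ i″ j″} a x x′ x″ →
    i < j → j ≤ N → i′ < j′ → j′ ≤ N → i″ < j″ → j″ ≤ N →
    (∀ t → t < N → Joint a (piece i j x t) (piece i′ j′ x′ t) (piece i″ j″ x″ t)) →
    Joint (merge a) x x′ x″
  joint-head {N} {i} {j} {i′} {j′} {i″} {j″} a x x′ x″ p q p′ q′ p″ q″ J = record
    { agree′   = letter {N} {i} {j} {i′} {j′} a x x′ p q p′ q′ (λ t l → agree′ (J t l))
    ; agree″   = letter {N} {i} {j} {i″} {j″} a x x″ p q p″ q″ (λ t l → agree″ (J t l))
    ; cover    = λ { refl → map-⊎ (piece-nothing i′ j′ x′ i) (piece-nothing i″ j″ x″ i)
                     (cover (J i (<-≤-trans p q)) (piece-mid nothing ≤-refl p)) }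
    ; sub′     = λ { refl → piece-nothing i j x i′
                     (sub′ (J i′ (<-≤-trans p′ q′)) (piece-mid nothing ≤-refl p′)) }
    ; sub″     = λ { refl → piece-nothing i j x i″
                     (sub″ (J i″ (<-≤-trans p″ q″)) (piece-mid nothing ≤-refl p″)) }
    ; disjoint = λ { refl refl → let t , l , m′ , m″ = overlapping a p′ q′ p″ q″ J′ in
                     disjoint (J t l) m′ m″ }
    }
    where
    J′ : ∀ t → t < N → fromMaybe a (piece i′ j′ x′ t) ≡ fromMaybe a (piece i″ j″ x″ t)
    J′ t l = trans (sym (agree′ (J t l))) (agree″ (J t l))

  block : ∀ {N} → ℕ → ℕ → Maybe (Fin (suc k)) → Template K N
  block i j x = tabulate (λ t → piece i j x (toℕ t))

  lookup-block : ∀ {N} i j x {t} (l : t < N) → lookup (block i j x) (fromℕ< l) ≡ piece i j x t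
  lookup-block i j x l =
    trans (lookup∘tabulate _ (fromℕ< l)) (cong (piece i j x) (toℕ-fromℕ< l))

  -- The point 1^i 0^(N-i): an empty interval leaves only ones and zeros.
  chain : ∀ N → ℕ → Point K N
  chain N i = η (block i i nothing) zero

  η-block-cong : ∀ {N} i j x i′ j′ x′ {a a′} →
    (∀ t → fromMaybe a (piece i j x t) ≡ fromMaybe a′ (piece i′ j′ x′ t)) →
    η {n = N} (block i j x) a ≡ η (block i′ j′ x′) a′
  η-block-cong i j x i′ j′ x′ {a} {a′} h =
    trans (sym (tabulate-∘ (fromMaybe a) _)) (trans (tabulate-cong (λ t → h (toℕ t))) (tabulate-∘ (fromMaybe a′) _))

  chain-low : ∀ {N i j} → i ≤ j → η {n = N} (block i j nothing) zero ≡ chain N i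
  chain-low {i = i} {j} i≤j = η-block-cong i j nothing i i nothing go
    where
    go : ∀ t → fromMaybe zero (piece i j nothing t) ≡ fromMaybe zero (piece i i nothing t)
    go t with piece i j nothing t | region i j t nothing
    ... | _ | left p    = cong (fromMaybe zero) (sym (piece-left i nothing p))
    ... | _ | mid p _   = cong (fromMaybe zero) (sym (piece-right nothing p p))
    ... | _ | right p _ = cong (fromMaybe zero) (sym (piece-right nothing p p))

  -- The letter `zero` of the smaller alphabet is written as 1, which extends the ones up to `j`. In
  -- `chain-low` the letter 0 of the larger alphabet extends the zeros down to `i` instead.
  chain-high : ∀ {N i j} → i ≤ j → η {n = N} (block i j (just zero)) zero ≡ chain N j
  chain-high {i = i} {j} i≤j = η-block-cong i j (just zero) j j nothing go
    where
    go : ∀ t → fromMaybe zero (piece i j (just zero) t) ≡ fromMaybe zero (piece j j nothing t)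
    go t with piece i j (just zero) t | region i j t (just zero)
    ... | _ | left p    = cong (fromMaybe zero) (sym (piece-left j nothing (<-≤-trans p i≤j)))
    ... | _ | mid _ p   = cong (fromMaybe zero) (sym (piece-left j nothing p))
    ... | _ | right _ p = cong (fromMaybe zero) (sym (piece-right nothing p p))

  -- The letter `suc y` merges to `y`, which the block writes as `suc y` again. Only the letter 0 is
  -- altered by merging and rewriting.
  block-suc : ∀ {N} i j x (y : Fin (suc k)) →
    η {n = N} (block i j x) (suc y) ≡ η (block i j (just (fromMaybe y x))) zero
  block-suc i j x y = η-block-cong i j x i j (just (fromMaybe y x)) go
    where
    lift : ∀ x → fromMaybe (suc y) (Maybe.map suc x) ≡ suc (fromMaybe y x)
    lift nothing  = refl
    lift (just _) = refl
    go : ∀ t → fromMaybe (suc y) (piece i j x t) ≡ fromMaybe zero (piece i j (just (fromMaybe y x)) t)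
    go t with piece i j x t | region i j t x
    ... | _ | left p    = cong (fromMaybe zero) (sym (piece-left j _ p))
    ... | _ | mid p q   = trans (lift x) (cong (fromMaybe zero) (sym (piece-mid (just (fromMaybe y x)) p q)))
    ... | _ | right p q = cong (fromMaybe zero) (sym (piece-right _ p q))

  -- The colours of N + 1 chain points in all contexts coincide for some i < j, making the
  -- colouring blind to the switch 0 ↔ 1 on the block [i,j).
  insensitive : ∀ {r u s} → let N = (r ^ (K ^ s)) ^ (suc k ^ u) in
    (c : Point (suc k) u → Point K (N + s) → Fin r) →
    Σ (Fin (suc N)) λ i → Σ (Fin (suc N)) λ j → i Fin.< j ×
      (∀ p q → c p (chain N (toℕ i) ++ q) ≡ c p (chain N (toℕ j) ++ q))
  insensitive {r} {u} {s} c =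
    let i , j , i<j , eq = pigeonhole (n<1+n N) profile in i , j , i<j , blind {i} {j} eq
    where
    -- The number of possible profiles, that is, of `r`-colourings of all contexts `(p , q)`; there
    -- is one more chain point than that.
    N : ℕ
    N = (r ^ (K ^ s)) ^ (suc k ^ u)
    colour : Fin (suc N) → Fin (suc k ^ u) → Fin (K ^ s) → Fin r
    colour i x y = c (decode {suc k} {u} x) (chain N (toℕ i) ++ decode {K} {s} y)
    profile : Fin (suc N) → Fin N
    profile i = funToFin (λ x → funToFin (colour i x))
    unpack : ∀ {i j} → profile i ≡ profile j → ∀ x y → colour i x y ≡ colour j x y
    unpack {i} {j} eq x y = begin
      colour i x y                               ≡⟨ finToFun-funToFin (colour i x) y ⟨
      finToFun (funToFin (colour i x)) y         ≡⟨ cong (λ z → finToFun z y) row ⟩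
      finToFun (funToFin (colour j x)) y         ≡⟨ finToFun-funToFin (colour j x) y ⟩
      colour j x y                               ∎
      where
      open ≡-Reasoning
      row : funToFin (colour i x) ≡ funToFin (colour j x)
      row = trans (sym (finToFun-funToFin (λ x → funToFin (colour i x)) x))
        (trans (cong (λ z → finToFun {r ^ (K ^ s)} {suc k ^ u} z x) eq)
               (finToFun-funToFin (λ x → funToFin (colour j x)) x))
    blind : ∀ {i j} → profile i ≡ profile j →
      ∀ p q → c p (chain N (toℕ i) ++ q) ≡ c p (chain N (toℕ j) ++ q)
    blind {i} {j} eq p q = subst₂ (λ p q → c p (chain N (toℕ i) ++ q) ≡ c p (chain N (toℕ j) ++ q))
      (decode-encode p) (decode-encode q) (unpack {i} {j} eq (encode p) (encode q))

-- Opening the blocks.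

tripodal-++⁻ˡ : ∀ {k m n a} (b b′ b″ : Template k m) {v v′ v″ : Template k n} →
  Tripodal a (b ++ v) (b′ ++ v′) (b″ ++ v″) → Tripodal a b b′ b″
tripodal-++⁻ˡ {n = n} b b′ b″ {v} {v′} {v″} T i
  rewrite sym (lookup-++ˡ b v i) | sym (lookup-++ˡ b′ v′ i) | sym (lookup-++ˡ b″ v″ i) = T (i ↑ˡ n)

tripodal-++⁻ʳ : ∀ {k m n a} (b b′ b″ : Template k m) {v v′ v″ : Template k n} →
  Tripodal a (b ++ v) (b′ ++ v′) (b″ ++ v″) → Tripodal a v v′ v″
tripodal-++⁻ʳ {m = m} b b′ b″ {v} {v′} {v″} T i
  rewrite sym (lookup-++ʳ b v i) | sym (lookup-++ʳ b′ v′ i) | sym (lookup-++ʳ b″ v″ i) = T (m ↑ʳ i)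

-- One unopened coordinate becomes a block of `N` coordinates. Every item is expanded along every
-- nonempty interval, since the interval to be used depends on the colouring.
openBlock : ∀ {k r u s} → Mixed k r (suc u) s → ∃[ s′ ] Mixed k r u s′
openBlock {k} {r} {u} {s} M = N + s , record
  { items      = cartesianProductWith expand (Mixed.items M) intervals
  ; isLine     = isLine
  ; tripodFree = tripodFree
  ; ramsey     = ramsey
  }
  where
  N : ℕ
  N = (r ^ (suc (suc k) ^ s)) ^ (suc k ^ u)

  Interval : Set
  Interval = Fin (suc N) × Fin (suc N)

  ordered? : Decidable (λ (ij : Interval) → proj₁ ij Fin.< proj₂ ij)
  ordered? (i , j) = toℕ i <? toℕ j

  intervals : List Interval
  intervals = filter ordered? (cartesianProduct (allFin (suc N)) (allFin (suc N)))

  expand : Template (suc k) (suc u) × Template (suc (suc k)) s → Interval →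
    Template (suc k) u × Template (suc (suc k)) (N + s)
  expand (x ∷ w , v) (i , j) = w , block (toℕ i) (toℕ j) x ++ v

  data Expanded (w : Template (suc k) u) : Template (suc (suc k)) (N + s) → Set where
    expanded : ∀ x v i j → (x ∷ w , v) ∈ Mixed.items M → i < j → j ≤ N →
      Expanded w (block i j x ++ v)

  expanded⁻ : ∀ {w v} → (w , v) ∈ cartesianProductWith expand (Mixed.items M) intervals → Expanded w v
  expanded⁻ e∈ with ∈-cartesianProductWith⁻ expand (Mixed.items M) intervals e∈
  ... | (x ∷ w , v) , (i , j) , m , ij∈ , refl = expanded x v (toℕ i) (toℕ j) m
    (proj₂ (∈-filter⁻ ordered? {xs = cartesianProduct (allFin (suc N)) (allFin (suc N))} ij∈))
    (≤-pred (toℕ<n j))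

  isLine : ∀ {w v} → (w , v) ∈ cartesianProductWith expand (Mixed.items M) intervals → IsLine w ⊎ IsLine v
  isLine e∈ with expanded⁻ e∈
  ... | expanded x v i j m i<j j≤N with Mixed.isLine M m
  -- The opened coordinate moves, and as its interval is nonempty, the left end of the interval
  -- moves.
  ... | inj₁ (zero , refl) = inj₂ (fromℕ< i<N ↑ˡ s , trans (lookup-++ˡ (block i j x) v (fromℕ< i<N))
          (trans (lookup-block i j x i<N) (piece-mid x ≤-refl i<j)))
    where
    i<N : i < N
    i<N = <-≤-trans i<j j≤N
  ... | inj₁ (suc t , eq) = inj₁ (t , eq)
  ... | inj₂ (t , eq)     = inj₂ (N ↑ʳ t , trans (lookup-++ʳ (block {N = N} i j x) v t) eq)

  tripodFree : ∀ {w w′ w″ v v′ v″} → let 𝓔 = cartesianProductWith expand (Mixed.items M) intervals in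
    (w , v) ∈ 𝓔 → (w′ , v′) ∈ 𝓔 → (w″ , v″) ∈ 𝓔 →
    ∀ a → Tripodal (merge a) w w′ w″ → Tripodal a v v′ v″ → ⊥
  tripodFree {w} {w′} {w″} e∈ e′∈ e″∈ a Tw Tv with expanded⁻ e∈ | expanded⁻ e′∈ | expanded⁻ e″∈
  ... | expanded x v i j m i<j j≤N | expanded x′ v′ i′ j′ m′ i′<j′ j′≤N
      | expanded x″ v″ i″ j″ m″ i″<j″ j″≤N =
    Mixed.tripodFree M m m′ m″ a Txw
      (tripodal-++⁻ʳ (block {N = N} i j x) (block i′ j′ x′) (block i″ j″ x″) Tv)
    where
    Tb : Tripodal a (block {N = N} i j x) (block i′ j′ x′) (block i″ j″ x″)
    Tb = tripodal-++⁻ˡ (block i j x) (block i′ j′ x′) (block i″ j″ x″) Tv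
    pieces : ∀ t → t < N → Joint a (piece i j x t) (piece i′ j′ x′ t) (piece i″ j″ x″ t)
    pieces t l rewrite sym (lookup-block i j x l) | sym (lookup-block i′ j′ x′ l)
      | sym (lookup-block i″ j″ x″ l) = Tb (fromℕ< l)
    Txw : Tripodal (merge a) (x ∷ w) (x′ ∷ w′) (x″ ∷ w″)
    Txw zero    = joint-head a x x′ x″ i<j j≤N i′<j′ j′≤N i″<j″ j″≤N pieces
    Txw (suc t) = Tw t

  -- Represents the letter `y` by `suc y` on the interval, so that the merged letter `zero` is
  -- represented by 1.
  restrict : (Point (suc k) u → Point (suc (suc k)) (N + s) → Fin r) → ℕ → ℕ →
    Point (suc k) (suc u) → Point (suc (suc k)) s → Fin r
  restrict c i j (y ∷ p) q = c p (η (block i j (just y)) zero ++ q)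

  ramsey : (c : Point (suc k) u → Point (suc (suc k)) (N + s) → Fin r) →
    ∃₂ λ w v → (w , v) ∈ cartesianProductWith expand (Mixed.items M) intervals ×
      (∀ a b → c (η w (merge a)) (η v a) ≡ c (η w (merge b)) (η v b))
  ramsey c with insensitive {k} {r} {u} {s} c
  ... | i , j , i<j , blind with Mixed.ramsey M (restrict c (toℕ i) (toℕ j))
  ... | x ∷ w , v , m , mono = w , block {N = N} (toℕ i) (toℕ j) x ++ v
    , ∈-cartesianProductWith⁺ expand m (∈-filter⁺ ordered? (∈-cartesianProduct⁺ (∈-allFin i) (∈-allFin j)) i<j)
    , λ a b → trans (transfer a) (trans (mono a b) (sym (transfer b)))
    where
    transfer-block : ∀ x p q a → c p (η (block (toℕ i) (toℕ j) x) a ++ q) ≡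
      c p (η (block (toℕ i) (toℕ j) (just (fromMaybe (merge a) x))) zero ++ q)
    transfer-block x        p q (suc y) = cong (λ b → c p (b ++ q)) (block-suc (toℕ i) (toℕ j) x y)
    transfer-block (just y) p q zero    = refl
    -- Only here does the line put the letter 0 on the interval; `blind` exchanges it for 1.
    transfer-block nothing  p q zero    =
      trans (cong (λ b → c p (b ++ q)) (chain-low {i = toℕ i} {toℕ j} (<⇒≤ i<j)))
        (trans (blind p q) (cong (λ b → c p (b ++ q)) (sym (chain-high {i = toℕ i} {toℕ j} (<⇒≤ i<j)))))
    transfer : ∀ a → c (η w (merge a)) (η (block (toℕ i) (toℕ j) x ++ v) a) ≡
      c (η w (merge a)) (η (block (toℕ i) (toℕ j) (just (fromMaybe (merge a) x))) zero ++ η v a)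
    transfer a = trans (cong (c (η w (merge a))) (map-++ (fromMaybe a) (block (toℕ i) (toℕ j) x) v))
      (transfer-block x (η w (merge a)) (η v a) a)

-- Induction on the alphabet.

openBlocks : ∀ {k r} u {s} → Mixed k r u s → ∃[ n ] Mixed k r 0 n
openBlocks zero    M = _ , M
openBlocks (suc u) M = openBlocks u (proj₂ (openBlock M))

fromHalesJewett : ∀ {k r n} → HalesJewett (suc k) r n → Mixed k r n 0
fromHalesJewett {k} {r} {n} H = record
  { items      = List.map (_, []) 𝓛
  ; isLine     = λ e∈ → case-isLine (∈-map⁻ (_, []) e∈)
  ; tripodFree = free
  ; ramsey     = λ c → let w , w∈ , mono = ramsey (λ p → c p []) in
                   w , [] , ∈-map⁺ (_, []) w∈ , λ a b → mono (merge a) (merge b)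
  }
  where
  open HalesJewett H
  case-isLine : ∀ {w} {v : Template (suc (suc k)) 0} →
    (∃[ w₀ ] (w₀ ∈ 𝓛 × (w , v) ≡ (w₀ , []))) → IsLine w ⊎ IsLine v
  case-isLine (_ , w∈ , refl) = inj₁ (isLine w∈)
  free : ∀ {w w′ w″} {v v′ v″ : Template (suc (suc k)) 0} → let 𝓔 = List.map (_, []) 𝓛 in
    (w , v) ∈ 𝓔 → (w′ , v′) ∈ 𝓔 → (w″ , v″) ∈ 𝓔 →
    ∀ a → Tripodal (merge a) w w′ w″ → Tripodal a v v′ v″ → ⊥
  free e∈ e′∈ e″∈ a T _ with ∈-map⁻ (_, []) e∈ | ∈-map⁻ (_, []) e′∈ | ∈-map⁻ (_, []) e″∈
  ... | _ , w∈ , refl | _ , w′∈ , refl | _ , w″∈ , refl = tripodFree w∈ w′∈ w″∈ (merge a) T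

toHalesJewett : ∀ {k r n} → Mixed k r 0 n → HalesJewett (suc (suc k)) r n
toHalesJewett {k} {r} {n} M = record
  { 𝓛          = List.map proj₂ items
  ; isLine     = line
  ; tripodFree = free
  ; ramsey     = found
  }
  where
  open Mixed M
  line : ∀ {v} → v ∈ List.map proj₂ items → IsLine v
  line v∈ with ∈-map⁻ proj₂ v∈
  ... | ([] , _) , m , refl with isLine m
  ... | inj₂ l = l
  free : TripodFree (List.map proj₂ items)
  free v∈ v′∈ v″∈ a T with ∈-map⁻ proj₂ v∈ | ∈-map⁻ proj₂ v′∈ | ∈-map⁻ proj₂ v″∈
  ... | ([] , _) , m , refl | ([] , _) , m′ , refl | ([] , _) , m″ , refl =
    tripodFree m m′ m″ a (λ ()) T
  found : ChromaticGt (List.map proj₂ items) r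
  found c with ramsey (λ _ → c)
  ... | w , v , m , mono = v , ∈-map⁺ proj₂ m , mono

-- The only line would have to be disjoint from itself to form a tripod. The empty alphabet is
-- included because `halesJewett` is later applied to fibres, whose size is not bounded below.
singleLine : ∀ {k r} → (∀ (a b : Fin k) → a ≡ b) → HalesJewett k r 1
singleLine {k} subsingleton = record
  { 𝓛          = (nothing ∷ []) ∷ []
  ; isLine     = λ { (here refl) → zero , refl }
  ; tripodFree = λ { (here refl) (here refl) (here refl) a → ¬tripodal-same {w = nothing ∷ []} (zero , refl) a }
  ; ramsey     = λ c → nothing ∷ [] , here refl , λ a b → cong (λ x → c (η (nothing ∷ []) x)) (subsingleton a b)
  }

halesJewett : ∀ k r → ∃[ n ] HalesJewett k r n
halesJewett zero          r = 1 , singleLine (λ ())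
halesJewett (suc zero)    r = 1 , singleLine (λ { zero zero → refl })
halesJewett (suc (suc k)) r =
  let n , H = halesJewett (suc k) r
      n′ , M = openBlocks n (fromHalesJewett H)
  in n′ , toHalesJewett M

-- Pictures of the partite construction.

-- The fibres of π over t, t + 1, … have already been treated: only on those below t must a
-- colouring be constant for a monochromatic line to be guaranteed.
record Picture (k r t n : ℕ) : Set where
  field
    𝓛           : List (Template k n)
    isLine      : ∀ {w} → w ∈ 𝓛 → IsLine w
    tripodFree  : TripodFree 𝓛
    noTriangles : NoTriangles 𝓛
    π           : Point k n → ℕ
    π-injective : ∀ {w} → w ∈ 𝓛 → ∀ {a b} → π (η w a) ≡ π (η w b) → a ≡ b
    ramsey      : (c : Point k n → Fin r) → (∀ p q → π p < t → π p ≡ π q → c p ≡ c q) →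
                  ∃[ w ] (w ∈ 𝓛 × Monochromatic c w)

-- Gluing copies along a system over the fibre.

module Amalgamation {k n b N : ℕ} (e : Fin b → Point k n) where

  -- The copy indexed by `w`: moving entries carry the given point, constant entries carry fixed
  -- points of the fibre.
  place : Template b N → Point k n → Vec (Point k n) N
  place w p = map (maybe e p) w

  -- The line `l` inside the copy indexed by `w`; its moving set is the product of the moving sets
  -- of `w` and `l`.
  blow : Template b N → Template k n → Template k (N * n)
  blow w l = concat (map (maybe (map just ∘ e) l) w)

  η-blow : ∀ w l a → η (blow w l) a ≡ concat (place w (η l a))
  η-blow w l a = begin
    map (fromMaybe a) (concat (map (maybe (map just ∘ e) l) w))     ≡⟨ map-concat (fromMaybe a) (map (maybe (map just ∘ e) l) w) ⟩
    concat (map (map (fromMaybe a)) (map (maybe (map just ∘ e) l) w)) ≡⟨ cong concat (map-∘ _ _ w) ⟨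
    concat (map (map (fromMaybe a) ∘ maybe (map just ∘ e) l) w)     ≡⟨ cong concat (map-cong symbol w) ⟩
    concat (place w (η l a))                                        ∎
    where
    open ≡-Reasoning
    symbol : ∀ x → map (fromMaybe a) (maybe (map just ∘ e) l x) ≡ maybe e (η l a) x
    symbol nothing  = refl
    symbol (just i) = trans (sym (map-∘ (fromMaybe a) just (e i))) (map-id (e i))

  lookup-blow : ∀ w l j s →
    lookup (blow w l) (combine j s) ≡ lookup (maybe (map just ∘ e) l (lookup w j)) s
  lookup-blow w l j s = trans (lookup-concat (map (maybe (map just ∘ e) l) w) j s)
    (cong (λ x → lookup x s) (lookup-map j (maybe (map just ∘ e) l) w))

  lookup-blow-moving : ∀ {w} l {j} s → Moving w j → lookup (blow w l) (combine j s) ≡ lookup l s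
  lookup-blow-moving {w} l {j} s m =
    trans (lookup-blow w l j s) (cong (λ x → lookup (maybe (map just ∘ e) l x) s) m)

  blow-moving⁺ : ∀ {w l j s} → Moving w j → Moving l s → Moving (blow w l) (combine j s)
  blow-moving⁺ {w} {l} {j} {s} m m′ = trans (lookup-blow-moving {w} l s m) m′

  blow-moving⁻ : ∀ {w l j s} → Moving (blow w l) (combine j s) → Moving w j × Moving l s
  blow-moving⁻ {w} {l} {j} {s} m = go (lookup w j) refl
    where
    go : ∀ x → lookup w j ≡ x → Moving w j × Moving l s
    go nothing  eq = eq , trans (sym (lookup-blow-moving {w} l s eq)) m
    go (just i) eq with trans (sym m) (trans (lookup-blow w l j s)
      (trans (cong (λ x → lookup (maybe (map just ∘ e) l x) s) eq) (lookup-map s just (e i))))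
    ... | ()

  place-moving : ∀ {w w′ p p′ j} → place w p ≡ place w′ p′ → Moving w j → Moving w′ j → p ≡ p′
  place-moving {w} {w′} {p} {p′} {j} eq m m′ = begin
    p                              ≡⟨ cong (maybe e p) m ⟨
    maybe e p (lookup w j)         ≡⟨ lookup-map j (maybe e p) w ⟨
    lookup (place w p) j           ≡⟨ cong (λ q → lookup q j) eq ⟩
    lookup (place w′ p′) j         ≡⟨ lookup-map j (maybe e p′) w′ ⟩
    maybe e p′ (lookup w′ j)       ≡⟨ cong (maybe e p′) m′ ⟩
    p′                             ∎
    where open ≡-Reasoning

  -- This is the gluing: over the fibre, `place w` runs through the points of the line `w`, with
  -- letters read through `e`.
  place-fibre : ∀ w i → place w (e i) ≡ map e (η w i)
  place-fibre w i = trans (map-cong symbol w) (map-∘ e (fromMaybe i) w)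
    where
    symbol : ∀ x → maybe e (e i) x ≡ e (fromMaybe i x)
    symbol nothing  = refl
    symbol (just _) = refl

  blow-meet : ∀ {w w′ l l′ a a′} → η (blow w l) a ≡ η (blow w′ l′) a′ →
    place w (η l a) ≡ place w′ (η l′ a′)
  blow-meet {w} {w′} {l} {l′} {a} {a′} eq = concat-injective _ _
    (trans (sym (η-blow w l a)) (trans eq (η-blow w′ l′ a′)))

  module Projection (π : Point k n → ℕ) (t : ℕ) (fibre : ∀ i → π (e i) ≡ t)
    (e-injective : ∀ {i j} → e i ≡ e j → i ≡ j) where

    -- On place w p only the moving entries can lie off the fibre over t, so this recovers π p.
    first : ∀ {N} → Vec (Point k n) N → ℕ
    first []       = t
    first (p ∷ ps) with π p ≟ t
    ... | yes _ = first ps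
    ... | no _  = π p

    first-skip : ∀ {N} p (ps : Vec _ N) → π p ≡ t → first (p ∷ ps) ≡ first ps
    first-skip p ps eq with π p ≟ t
    ... | yes _ = refl
    ... | no ≢t = contradiction eq ≢t

    first-stop : ∀ {N} p (ps : Vec _ N) → π p ≢ t → first (p ∷ ps) ≡ π p
    first-stop p ps ≢t with π p ≟ t
    ... | yes eq = contradiction eq ≢t
    ... | no _   = refl

    first-over : ∀ {N} (w : Template b N) {p} → π p ≡ t → first (map (maybe e p) w) ≡ t
    first-over []            eq = refl
    first-over (nothing ∷ w) eq = trans (first-skip _ _ eq) (first-over w eq)
    first-over (just i ∷ w)  eq = trans (first-skip _ _ (fibre i)) (first-over w eq)

    first-off : ∀ {N} (w : Template b N) {p} → π p ≢ t → IsLine w → first (map (maybe e p) w) ≡ π p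
    first-off (nothing ∷ w) ≢t _           = first-stop _ _ ≢t
    first-off (just i ∷ w)  ≢t (suc j , m) =
      trans (first-skip _ _ (fibre i)) (first-off w ≢t (j , m))

    first-place : ∀ {w p} → IsLine w → first (place w p) ≡ π p
    first-place {w} {p} line with π p ≟ t
    ... | yes eq = trans (first-over w eq) (sym eq)
    ... | no ≢t  = first-off w ≢t line

    π′ : Point k (N * n) → ℕ
    π′ q = first (proj₁ (group N n q))

    π′-concat : ∀ (qs : Vec (Point k n) N) → π′ (concat qs) ≡ first qs
    π′-concat qs = cong first (concat-injective (proj₁ (group N n (concat qs))) qs
      (sym (proj₂ (group N n (concat qs)))))

    π′-place : ∀ {w p} → IsLine w → π′ (concat (place w p)) ≡ π p
    π′-place {w} {p} line = trans (π′-concat (place w p)) (first-place {w} line)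

    π′-blow : ∀ {w l a} → IsLine w → π′ (η (blow w l) a) ≡ π (η l a)
    π′-blow {w} {l} {a} line = trans (cong π′ (η-blow w l a)) (π′-place {w} line)

    place-π : ∀ {w w′ p p′} → IsLine w → IsLine w′ → place w p ≡ place w′ p′ → π p ≡ π p′
    place-π {w} {w′} l l′ eq =
      trans (sym (first-place {w} l)) (trans (cong first eq) (first-place {w′} l′))

    off-fibre : ∀ {i p} → π p ≢ t → e i ≢ p
    off-fibre {i} ≢t refl = ≢t (fibre i)

    -- A point off the fibre differs from every `e i`, so its occurrences reveal the moving
    -- coordinates; the other entries give the constants.
    place-injective : ∀ {M} {w w′ : Template b M} {p p′} → π p ≢ t → π p′ ≢ t →
      map (maybe e p) w ≡ map (maybe e p′) w′ → w ≡ w′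
    place-injective {w = []}          {[]}           _ _  _  = refl
    place-injective {w = nothing ∷ w} {nothing ∷ w′} o o′ eq =
      cong (nothing ∷_) (place-injective o o′ (∷-injectiveʳ eq))
    place-injective {w = nothing ∷ w} {just i ∷ w′}  o o′ eq =
      contradiction (sym (∷-injectiveˡ eq)) (off-fibre o)
    place-injective {w = just i ∷ w}  {nothing ∷ w′} o o′ eq =
      contradiction (∷-injectiveˡ eq) (off-fibre o′)
    place-injective {w = just i ∷ w}  {just i′ ∷ w′} o o′ eq =
      cong₂ _∷_ (cong just (e-injective (∷-injectiveˡ eq))) (place-injective o o′ (∷-injectiveʳ eq))

    -- The second point is off the fibre too, because `first` recovers its projection from the
    -- common value.
    same-copy : ∀ {w w′ p p′} → IsLine w → IsLine w′ → π p ≢ t → place w p ≡ place w′ p′ → w ≡ w′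
    same-copy {w} {w′} l l′ o eq =
      place-injective o (λ eq′ → o (trans (place-π {w} {w′} l l′ eq) eq′)) eq

moving? : ∀ {k n} (w : Template k n) i → Dec (Moving w i)
moving? w i = ≡-dec Fin._≟_ (lookup w i) nothing

-- The amalgamation step over one fibre.

amalgamate : ∀ {k r t n} → Picture k r (suc t) n → ∃[ n′ ] Picture k r t n′
amalgamate {k} {r} {t} {n} P = N * n , record
  { 𝓛           = 𝓛′
  ; isLine      = isLine′
  ; tripodFree  = tripodFree′
  ; noTriangles = noTriangles′
  ; π           = π′
  ; π-injective = π′-injective
  ; ramsey      = ramsey′
  }
  where
  open Picture P

  open Enumeration (enumerate {k ^ n} (λ x → π (decode {k} {n} x) ≟ t))

  e : Fin size → Point k n
  e = decode ∘ elem

  e-injective : ∀ {i j} → e i ≡ e j → i ≡ j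
  e-injective = injective ∘ decode-injective {k} {n}

  e-complete : ∀ {p} → π p ≡ t → ∃[ i ] e i ≡ p
  e-complete {p} eq =
    let i , eqᵢ = complete (encode p) (trans (cong π (decode-encode p)) eq)
    in i , trans (cong (decode {k} {n}) eqᵢ) (decode-encode p)

  N : ℕ
  N = proj₁ (halesJewett size r)

  module B = HalesJewett (proj₂ (halesJewett size r))

  open Amalgamation {k} {n} {size} {N} e
  open Projection π t sound e-injective

  𝓛′ : List (Template k (N * n))
  𝓛′ = cartesianProductWith blow B.𝓛 𝓛

  data Copy : Template k (N * n) → Set where
    copy : ∀ w l → w ∈ B.𝓛 → l ∈ 𝓛 → Copy (blow w l)

  copy⁻ : ∀ {L} → L ∈ 𝓛′ → Copy L
  copy⁻ L∈ with ∈-cartesianProductWith⁻ blow B.𝓛 𝓛 L∈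
  ... | w , l , w∈ , l∈ , refl = copy w l w∈ l∈

  isLine′ : ∀ {L} → L ∈ 𝓛′ → IsLine L
  isLine′ L∈ with copy⁻ L∈
  ... | copy w l w∈ l∈ with B.isLine w∈ | isLine l∈
  ... | j , m | s , m′ = combine j s , blow-moving⁺ {w} {l} m m′

  π′-injective : ∀ {L} → L ∈ 𝓛′ → ∀ {a b} → π′ (η L a) ≡ π′ (η L b) → a ≡ b
  π′-injective L∈ eq with copy⁻ L∈
  ... | copy w l w∈ l∈ = π-injective l∈
    (trans (sym (π′-blow {w} {l} (B.isLine w∈))) (trans eq (π′-blow {w} {l} (B.isLine w∈))))

  -- Off the fibre the common point determines the copy, so the tripod would already occur in `𝓛`.
  -- Over the fibre it descends to `𝓛` or to `B.𝓛`.
  tripodFree′ : TripodFree 𝓛′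
  tripodFree′ L∈ L′∈ L″∈ a T with copy⁻ L∈ | copy⁻ L′∈ | copy⁻ L″∈
  ... | copy w l w∈ l∈ | copy w′ l′ w′∈ l′∈ | copy w″ l″ w″∈ l″∈ = split (π (η l a) ≟ t)
    where
    line = B.isLine w∈
    line′ = B.isLine w′∈
    line″ = B.isLine w″∈

    meet′ : place w (η l a) ≡ place w′ (η l′ a)
    meet′ = blow-meet {w} {w′} {l} {l′} (tripodal⇒η′ {w = blow w l} {blow w′ l′} {blow w″ l″} T)

    meet″ : place w (η l a) ≡ place w″ (η l″ a)
    meet″ = blow-meet {w} {w″} {l} {l″} (tripodal⇒η″ {w = blow w l} {blow w′ l′} {blow w″ l″} T)

    same : w ≡ w′ → w ≡ w″ → ⊥
    same refl refl = tripodFree l∈ l′∈ l″∈ a inner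
      where
      inner : Tripodal a l l′ l″
      inner s rewrite sym (lookup-blow-moving {w} l s (proj₂ line))
        | sym (lookup-blow-moving {w} l′ s (proj₂ line))
        | sym (lookup-blow-moving {w} l″ s (proj₂ line)) = T (combine (proj₁ line) s)

    sub-w′ : ∀ {j s} → Moving w′ j → Moving l′ s → Moving w j × Moving l s
    sub-w′ {j} {s} m m′ = blow-moving⁻ {w} {l} (sub′ (T (combine j s)) (blow-moving⁺ {w′} {l′} m m′))

    sub-w″ : ∀ {j s} → Moving w″ j → Moving l″ s → Moving w j × Moving l s
    sub-w″ {j} {s} m m′ = blow-moving⁻ {w} {l} (sub″ (T (combine j s)) (blow-moving⁺ {w″} {l″} m m′))

    cover-w : ∀ {j s} → Moving w j → Moving l s →
      (Moving w′ j × Moving l′ s) ⊎ (Moving w″ j × Moving l″ s)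
    cover-w {j} {s} m m′ = map-⊎ (blow-moving⁻ {w′} {l′}) (blow-moving⁻ {w″} {l″})
      (cover (T (combine j s)) (blow-moving⁺ {w} {l} m m′))

    disjoint-w : ∀ {j s} → Moving w′ j → Moving l′ s → Moving w″ j → Moving l″ s → ⊥
    disjoint-w {j} {s} m′ n′ m″ n″ =
      disjoint (T (combine j s)) (blow-moving⁺ {w′} {l′} m′ n′) (blow-moving⁺ {w″} {l″} m″ n″)

    fibre-meet : ∀ {p p′ i i′} v → e i ≡ p → e i′ ≡ p′ → place w p ≡ place v p′ → η w i ≡ η v i′
    fibre-meet {i = i} {i′} v refl refl eq = map-injective e-injective
      (trans (sym (place-fibre w i)) (trans eq (place-fibre v i′)))

    -- Over the fibre, the moving sets are products M_w × M_l, and M_w × M_l can only be split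
    -- into two such products along one of its two factors.
    over : ∀ {i i′ i″} → e i ≡ η l a → e i′ ≡ η l′ a → e i″ ≡ η l″ a → ⊥
    over {i} {i′} {i″} eq eq′ eq″
      with isLine l∈ | isLine l′∈ | isLine l″∈
    ... | s , n | s′ , n′ | s″ , n″
      -- A moving coordinate of `w′` also moves in `w`, so `w` and `w′` carry the same letter at the
      -- meeting point; likewise for `w″`.
      with refl ← moving-letter {w = w} {w′} (fibre-meet w′ eq eq′ meet′) (proj₁ (sub-w′ (proj₂ line′) n′)) (proj₂ line′)
         | refl ← moving-letter {w = w} {w″} (fibre-meet w″ eq eq″ meet″) (proj₁ (sub-w″ (proj₂ line″) n″)) (proj₂ line″)
      = decide (any? (λ j → moving? w′ j ×-dec moving? w″ j))
      where
      decide : Dec (∃[ j ] (Moving w′ j × Moving w″ j)) → ⊥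
      -- Keeping this `j` fixed, the splitting of the product becomes a splitting of the moving set
      -- of `l`.
      decide (yes (j , m′ , m″)) = tripodFree l∈ l′∈ l″∈ a
        (tripodal {w = l} {l′} {l″} (trans (sym eq) eq′) (trans (sym eq) eq″)
          ( (λ s n → map-⊎ proj₂ proj₂ (cover-w (proj₁ (sub-w′ m′ n′)) n))
          , (λ s n → proj₂ (sub-w′ m′ n))
          , (λ s n → proj₂ (sub-w″ m″ n))
          , (λ s nn → disjoint-w m′ (proj₁ nn) m″ (proj₂ nn)) ))
      -- Keeping moving coordinates of `l`, `l′` and `l″` fixed instead, the moving set of `w`
      -- splits, and `apart` makes the parts disjoint.
      decide (no apart) = B.tripodFree w∈ w′∈ w″∈ i
        (tripodal {w = w} {w′} {w″} (fibre-meet w′ eq eq′ meet′) (fibre-meet w″ eq eq″ meet″)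
          ( (λ j m → map-⊎ proj₁ proj₁ (cover-w m n))
          , (λ j m → proj₁ (sub-w′ m n′))
          , (λ j m → proj₁ (sub-w″ m n″))
          , (λ j mm → apart (j , mm)) ))

    split : Dec (π (η l a) ≡ t) → ⊥
    split (no off) = same (same-copy {w} {w′} line line′ off meet′) (same-copy {w} {w″} line line″ off meet″)
    split (yes on) = over (proj₂ (e-complete on))
      (proj₂ (e-complete (trans (sym (place-π {w} {w′} line line′ meet′)) on)))
      (proj₂ (e-complete (trans (sym (place-π {w} {w″} line line″ meet″)) on)))

  -- Lines from different copies meet only over t, and a line has at most one point over t.
  noTriangles′ : NoTriangles 𝓛′
  noTriangles′ L∈ L′∈ L″∈
    ((d , d₁ , d₂) , (p , (a , ea) , (a′ , ea′)) , (q , (b , eb) , (b″ , eb″)) , (o , (c′ , ec′) , (c″ , ec″)) , ¬common)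
    with copy⁻ L∈ | copy⁻ L′∈ | copy⁻ L″∈
  ... | copy w l w∈ l∈ | copy w′ l′ w′∈ l′∈ | copy w″ l″ w″∈ l″∈ =
    analyse (meet w∈ w′∈ ea ea′) (meet w∈ w″∈ eb eb″) (meet w′∈ w″∈ ec′ ec″)
    where
    meet : ∀ {v v′ m m′ x x′ p} → v ∈ B.𝓛 → v′ ∈ B.𝓛 →
      η (blow v m) x ≡ p → η (blow v′ m′) x′ ≡ p → π′ p ≡ t ⊎ v ≡ v′
    meet {v} {v′} {m} {m′} {x} v∈ v′∈ refl e′ with π (η m x) ≟ t
    ... | yes on = inj₁ (trans (π′-blow {v} {m} (B.isLine v∈)) on)
    ... | no off = inj₂ (same-copy {v} {v′} (B.isLine v∈) (B.isLine v′∈) off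
                     (blow-meet {v} {v′} {m} {m′} (sym e′)))

    once : ∀ {L x y p q} → L ∈ 𝓛′ → η L x ≡ p → η L y ≡ q → π′ p ≡ t → π′ q ≡ t → p ≡ q
    once {L} L∈ refl refl h h′ = cong (η L) (π′-injective L∈ (trans h (sym h′)))

    inside : ∀ {v m m′} → v ∈ B.𝓛 → ∀ {x x′ p} → η (blow v m) x ≡ p → η (blow v m′) x′ ≡ p →
      η m x ≡ η m′ x′
    inside {v} {m} {m′} v∈ h h′ = place-moving {v} {v}
      (blow-meet {v} {v} {m} {m′} (trans h (sym h′))) (proj₂ (B.isLine v∈)) (proj₂ (B.isLine v∈))

    same : w ≡ w′ → w ≡ w″ → ⊥
    same refl refl = noTriangles l∈ l′∈ l″∈
      ( (d ∘ cong (blow w) , d₁ ∘ cong (blow w) , d₂ ∘ cong (blow w))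
      , (η l a , (a , refl) , (a′ , sym (inside w∈ ea ea′)))
      , (η l b , (b , refl) , (b″ , sym (inside w∈ eb eb″)))
      , (η l′ c′ , (c′ , refl) , (c″ , sym (inside w∈ ec′ ec″)))
      , λ { (_ , (x , refl) , (y , ey) , (z , ez)) → ¬common
            (η (blow w l) x , (x , refl) , (y , onto ey) , (z , onto ez)) } )
      where
      onto : ∀ {m x y} → η m y ≡ η l x → η (blow w m) y ≡ η (blow w l) x
      onto {m} {x} {y} h = trans (η-blow w m y) (trans (cong (concat ∘ place w) h) (sym (η-blow w l x)))

    -- If two meeting points lie over `t`, they coincide, because they share a line, and this gives
    -- a common point. Otherwise two of the equalities hold, and all three lines lie in one copy.
    analyse : π′ p ≡ t ⊎ w ≡ w′ → π′ q ≡ t ⊎ w ≡ w″ → π′ o ≡ t ⊎ w′ ≡ w″ → ⊥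
    analyse (inj₁ h) (inj₁ h′) _        = ¬common (p , (a , ea) , (a′ , ea′) ,
      (b″ , trans eb″ (sym (once L∈ ea eb h h′))))
    analyse (inj₁ h) _        (inj₁ h′) = ¬common (p , (a , ea) , (a′ , ea′) ,
      (c″ , trans ec″ (sym (once L′∈ ea′ ec′ h h′))))
    analyse _        (inj₁ h) (inj₁ h′) = ¬common (q , (b , eb) ,
      (c′ , trans ec′ (sym (once L″∈ eb″ ec″ h h′))) , (b″ , eb″))
    analyse (inj₂ h) (inj₂ h′) _        = same h h′
    analyse (inj₂ h) _        (inj₂ h′) = same h (trans h h′)
    analyse _        (inj₂ h) (inj₂ h′) = same (trans h (sym h′)) h

  -- A line `w` monochromatic for the colouring of the glued fibre makes the colouring pulled back
  -- along `place w` constant over `t`. Over smaller values constancy is inherited from `c`, so the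
  -- old picture applies at stage `suc t`.
  ramsey′ : (c : Point k (N * n) → Fin r) → (∀ p q → π′ p < t → π′ p ≡ π′ q → c p ≡ c q) →
    ∃[ L ] (L ∈ 𝓛′ × Monochromatic c L)
  ramsey′ c fibrewise with B.ramsey (λ y → c (concat (map e y)))
  ... | w , w∈ , mono-w =
    let l , l∈ , mono = ramsey (λ p → c (concat (place w p))) fibrewise-w
    in blow w l , ∈-cartesianProductWith⁺ blow w∈ l∈ ,
       λ a b → trans (cong c (η-blow w l a)) (trans (mono a b) (cong c (sym (η-blow w l b))))
    where
    over : ∀ {p q} → ∃[ i ] e i ≡ p → ∃[ j ] e j ≡ q → c (concat (place w p)) ≡ c (concat (place w q))
    over (i , refl) (j , refl) = trans (cong (c ∘ concat) (place-fibre w i))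
      (trans (mono-w i j) (cong (c ∘ concat) (sym (place-fibre w j))))
    fibrewise-w : ∀ p q → π p < suc t → π p ≡ π q → c (concat (place w p)) ≡ c (concat (place w q))
    fibrewise-w p q p≤t eq with m<1+n⇒m<n∨m≡n p≤t
    ... | inj₁ p<t = fibrewise _ _ (subst (_< t) (sym (π′-place {w} (B.isLine w∈))) p<t)
                       (trans (π′-place {w} (B.isLine w∈)) (trans eq (sym (π′-place {w} (B.isLine w∈)))))
    ... | inj₂ p≡t = over (e-complete p≡t) (e-complete (trans (sym eq) p≡t))

amalgamateAll : ∀ {k r} t {n} → Picture k r t n → ∃[ n′ ] Picture k r 0 n′
amalgamateAll zero    P = _ , P
amalgamateAll (suc t) P = amalgamateAll t (proj₂ (amalgamate P))

-- The initial picture of disjoint lines.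

module _ {k : ℕ} where

  flag : Maybe (Fin (suc (suc k))) → Fin (suc (suc k))
  flag nothing  = suc zero
  flag (just _) = zero

  -- The second half records which coordinates of h move, so that distinct lines become disjoint.
  tagged : ∀ {n} → Template (suc (suc k)) n → Template (suc (suc k)) (n + n)
  tagged h = h ++ map (just ∘ flag) h

  η-tagged : ∀ {n} (h : Template _ n) a → η (tagged h) a ≡ η h a ++ map flag h
  η-tagged h a = trans (map-++ (fromMaybe a) h _)
    (cong (η h a ++_) (sym (map-∘ (fromMaybe a) (just ∘ flag) h)))

  -- Equal flags mean equal moving sets, and on the remaining coordinates the common point shows the
  -- constants of both lines.
  flags-determine : ∀ {n} {h h′ : Template _ n} {a a′} →
    η h a ≡ η h′ a′ → map flag h ≡ map flag h′ → h ≡ h′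
  flags-determine {h = []}          {[]}           _  _  = refl
  flags-determine {h = nothing ∷ h} {nothing ∷ h′} eq fl =
    cong (nothing ∷_) (flags-determine (∷-injectiveʳ eq) (∷-injectiveʳ fl))
  flags-determine {h = just x ∷ h}  {just x′ ∷ h′} eq fl =
    cong₂ _∷_ (cong just (∷-injectiveˡ eq)) (flags-determine (∷-injectiveʳ eq) (∷-injectiveʳ fl))
  flags-determine {h = nothing ∷ h} {just x′ ∷ h′} eq fl = contradiction (∷-injectiveˡ fl) λ ()
  flags-determine {h = just x ∷ h}  {nothing ∷ h′} eq fl = contradiction (∷-injectiveˡ fl) λ ()

  tagged-disjoint : ∀ {n} {h h′ : Template _ n} {a a′} → η (tagged h) a ≡ η (tagged h′) a′ → h ≡ h′
  tagged-disjoint {h = h} {h′} {a} {a′} eq =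
    let eqˡ , eqʳ = ++-injective (η h a) (η h′ a′) (trans (sym (η-tagged h a)) (trans eq (η-tagged h′ a′)))
    in flags-determine eqˡ eqʳ

  -- All values of `π` lie below `suc (suc k) ^ n`, so at this stage the colourings are constant on
  -- every fibre and come from colourings of the original cube.
  pictureZero : ∀ {r n} → HalesJewett (suc (suc k)) r n → Picture (suc (suc k)) r (suc (suc k) ^ n) (n + n)
  pictureZero {r} {n} H = record
    { 𝓛           = List.map tagged 𝓛
    ; isLine      = isLine′
    ; tripodFree  = tripodFree′
    ; noTriangles = noTriangles′
    ; π           = π
    ; π-injective = π-injective
    ; ramsey      = ramsey′
    }
    where
    open HalesJewett H

    π : Point (suc (suc k)) (n + n) → ℕ
    π p = toℕ (encode (take n p))

    π-++ : ∀ p q → π (p ++ q) ≡ toℕ (encode p)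
    π-++ p q = cong (toℕ ∘ encode) (take-++ p q)

    π-tagged : ∀ h a → π (η (tagged h) a) ≡ toℕ (encode (η h a))
    π-tagged h a = trans (cong π (η-tagged h a)) (π-++ (η h a) (map flag h))

    isLine′ : ∀ {L} → L ∈ List.map tagged 𝓛 → IsLine L
    isLine′ L∈ with ∈-map⁻ tagged L∈
    ... | h , h∈ , refl with isLine h∈
    ... | i , m = i ↑ˡ n , trans (lookup-++ˡ h _ i) m

    meet : ∀ {L L′ a a′} → L ∈ List.map tagged 𝓛 → L′ ∈ List.map tagged 𝓛 → η L a ≡ η L′ a′ → L ≡ L′
    meet L∈ L′∈ eq with ∈-map⁻ tagged L∈ | ∈-map⁻ tagged L′∈
    ... | h , _ , refl | h′ , _ , refl = cong tagged (tagged-disjoint {h = h} {h′} eq)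

    tripodFree′ : TripodFree (List.map tagged 𝓛)
    tripodFree′ {L} {L′} {L″} L∈ L′∈ L″∈ a T
      with refl ← meet L∈ L′∈ (tripodal⇒η′ {w = L} {L′} {L″} T)
         | refl ← meet L∈ L″∈ (tripodal⇒η″ {w = L} {L′} {L″} T)
      = ¬tripodal-same {w = L} (isLine′ L∈) a T

    noTriangles′ : NoTriangles (List.map tagged 𝓛)
    noTriangles′ L∈ L′∈ _ ((d , _) , (_ , (_ , e) , (_ , e′)) , _) = d (meet L∈ L′∈ (trans e (sym e′)))

    π-injective : ∀ {L} → L ∈ List.map tagged 𝓛 → ∀ {a b} → π (η L a) ≡ π (η L b) → a ≡ b
    π-injective L∈ {a} {b} eq with ∈-map⁻ tagged L∈
    ... | h , h∈ , refl = η-injective {w = h} (isLine h∈) (encode-injective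
      (toℕ-injective (trans (sym (π-tagged h a)) (trans eq (π-tagged h b)))))

    ramsey′ : (c : Point (suc (suc k)) (n + n) → Fin r) →
      (∀ p q → π p < suc (suc k) ^ n → π p ≡ π q → c p ≡ c q) →
      ∃[ L ] (L ∈ List.map tagged 𝓛 × Monochromatic c L)
    -- The diagonal point `p ++ p` serves as a representative of the fibre over `p`.
    ramsey′ c fibrewise with ramsey (λ p → c (p ++ p))
    ... | h , h∈ , mono = tagged h , ∈-map⁺ tagged h∈ ,
      λ a b → trans (transfer a) (trans (mono a b) (sym (transfer b)))
      where
      transfer : ∀ a → c (η (tagged h) a) ≡ c (η h a ++ η h a)
      transfer a = fibrewise _ _ (toℕ<n (encode (take n (η (tagged h) a))))
        (trans (π-tagged h a) (sym (π-++ (η h a) (η h a))))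

-- Sparse systems in all large dimensions.

record Sparse (k r n : ℕ) : Set where
  field
    𝓛           : List (Template k n)
    isLine      : ∀ {w} → w ∈ 𝓛 → IsLine w
    tripodFree  : TripodFree 𝓛
    noTriangles : NoTriangles 𝓛
    ramsey      : ChromaticGt 𝓛 r

fromPicture : ∀ {k r n} → Picture k r 0 n → Sparse k r n
fromPicture P = record
  { 𝓛 = 𝓛 ; isLine = isLine ; tripodFree = tripodFree ; noTriangles = noTriangles
  ; ramsey = λ c → ramsey c (λ _ _ ()) }
  where open Picture P

-- A constant coordinate in front preserves intersections and common points, so one good dimension
-- yields all larger ones.
pad : ∀ {k r n} → Sparse (suc k) r n → Sparse (suc k) r (suc n)
pad {k} {r} {n} S = record
  { 𝓛           = List.map 0∷ 𝓛
  ; isLine      = isLine′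
  ; tripodFree  = tripodFree′
  ; noTriangles = noTriangles′
  ; ramsey      = ramsey′
  }
  where
  open Sparse S

  0∷ : Template (suc k) n → Template (suc k) (suc n)
  0∷ = just zero ∷_

  isLine′ : ∀ {L} → L ∈ List.map 0∷ 𝓛 → IsLine L
  isLine′ L∈ with ∈-map⁻ 0∷ L∈
  ... | w , w∈ , refl = let i , m = isLine w∈ in suc i , m

  tripodFree′ : TripodFree (List.map 0∷ 𝓛)
  tripodFree′ L∈ L′∈ L″∈ a T with ∈-map⁻ 0∷ L∈ | ∈-map⁻ 0∷ L′∈ | ∈-map⁻ 0∷ L″∈
  ... | _ , w∈ , refl | _ , w′∈ , refl | _ , w″∈ , refl = tripodFree w∈ w′∈ w″∈ a (T ∘ suc)

  unpad : ∀ w w′ → Intersect (0∷ w) (0∷ w′) → Intersect w w′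
  unpad w w′ (_ , (a , refl) , (a′ , e′)) = η w a , (a , refl) , (a′ , ∷-injectiveʳ e′)

  noTriangles′ : NoTriangles (List.map 0∷ 𝓛)
  noTriangles′ L∈ L′∈ L″∈ ((d , d₁ , d₂) , I , I₁ , I₂ , ¬common)
    with ∈-map⁻ 0∷ L∈ | ∈-map⁻ 0∷ L′∈ | ∈-map⁻ 0∷ L″∈
  ... | w , w∈ , refl | w′ , w′∈ , refl | w″ , w″∈ , refl = noTriangles w∈ w′∈ w″∈
    ( (d ∘ cong 0∷ , d₁ ∘ cong 0∷ , d₂ ∘ cong 0∷)
    , unpad w w′ I , unpad w w″ I₁ , unpad w′ w″ I₂
    , λ { (p , (a , e) , (a′ , e′) , (a″ , e″)) → ¬common
          (zero ∷ p , (a , cong (zero ∷_) e) , (a′ , cong (zero ∷_) e′) , (a″ , cong (zero ∷_) e″)) } )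

  ramsey′ : ChromaticGt (List.map 0∷ 𝓛) r
  ramsey′ c = let w , w∈ , mono = ramsey (λ p → c (zero ∷ p)) in 0∷ w , ∈-map⁺ 0∷ w∈ , mono

padTo : ∀ {k r m n} → m ≤′ n → Sparse (suc k) r m → Sparse (suc k) r n
padTo ≤′-refl     S = S
padTo (≤′-step l) S = pad (padTo l S)

sparseHalesJewett : ∀ k r → ∃[ n ] Sparse (suc (suc k)) r n
sparseHalesJewett k r =
  let m , H = halesJewett (suc (suc k)) r
      n , P = amalgamateAll (suc (suc k) ^ m) (pictureZero H)
  in n , fromPicture P

theorem3p7 : ∀ (k r : ℕ) → 2 ≤ k → 1 ≤ r →
    ∃[ n₀ ] (∀ (n : ℕ) → n₀ ≤ n →
    Σ (List (Template k n)) λ 𝓛 →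
    All IsLine 𝓛 × NoTripods 𝓛 × NoTriangles 𝓛 × ChromaticGt 𝓛 r)
theorem3p7 (suc (suc k)) r (s≤s (s≤s z≤n)) _ = proj₁ (sparseHalesJewett k r) , λ n n₀≤n →
  let open Sparse (padTo (≤⇒≤′ n₀≤n) (proj₂ (sparseHalesJewett k r)))
  in 𝓛 , All.tabulate isLine , tripodFree⇒noTripods isLine tripodFree , noTriangles , ramsey
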